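{- Let $G$ be a topological group, let $\mathfrak S$ be an I-finite $G$-subgroup system and let $A$ be a discrete $G$-module. The following data define a cohomological and stable RIC-functor $A_*=\mathrm H^0_{\mathfrak S}(A):\mathfrak S\to\mathsf{Ab}$: $A_*(H)=A^H$ for $H\in\mathfrak S_{\mathrm b}$; $\mathrm{res}_{I,H}:A^H\to A^I$ the canonical inclusion for $H\in\mathfrak S_{\mathrm b}$, $I\in\mathfrak S_{\mathrm r}(H)$; $\mathrm{ind}_{H,I}:A^I\to A^H$, $a\mapsto\sum_{h\in T}ha$, for $H\in\mathfrak S_{\mathrm b}$, $I\in\mathfrak S_{\mathrm i}(H)$ and an arbitrary left transversal $T$ of $I$ in $H$; $\mathrm{con}_{g,H}:A^H\to A^{{}^gH}$, $a\mapsto ga$, for $H\in\mathfrak S_{\mathrm b}$, $g\in G$. Moreover, if $\mathfrak M$ is an I-finite $G$-Mackey system, then $\mathrm H^0_{\mathfrak M}(A):\mathfrak M\to\mathsf{Ab}$ is a cohomological Mackey functor.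
   Context: ${}^gH=gHg^{ -1}$, $H^g=g^{ -1}Hg$. A $G$-subgroup system $\mathfrak S=(\mathfrak S_{\mathrm b},\mathfrak S_{\mathrm r},\mathfrak S_{\mathrm i})$ consists of a non-empty set $\mathfrak S_{\mathrm b}$ of subgroups of $G$ closed under conjugation and, for each $H\in\mathfrak S_{\mathrm b}$ and $\star\in\{\mathrm r,\mathrm i\}$, a set $\mathfrak S_\star(H)\subseteq\{I\in\mathfrak S_{\mathrm b}:I\le H\}$ with $H\in\mathfrak S_\star(H)$; $I\in\mathfrak S_\star(H)\Rightarrow\mathfrak S_\star(I)\subseteq\mathfrak S_\star(H)$; ${}^g\mathfrak S_\star(H)=\mathfrak S_\star({}^gH)$. It is I-finite if $[H:I]<\infty$ for $I\in\mathfrak S_{\mathrm i}(H)$. It is a $G$-Mackey system if for $I\in\mathfrak S_{\mathrm r}(H)$, $J\in\mathfrak S_{\mathrm i}(H)$ the set $I\backslash H/J$ is finite, $I\cap J\in\mathfrak S_{\mathrm r}(J)$ and $I\cap J\in\mathfrak S_{\mathrm i}(I)$. A RIC-functor $\Phi:\mathfrak S\to\mathsf{Ab}$ consists of abelian groups $\Phi(H)$ and homomorphisms $\mathrm{res}_{I,H}:\Phi(H)\to\Phi(I)$ ($I\in\mathfrak S_{\mathrm r}(H)$), $\mathrm{ind}_{H,I}:\Phi(I)\to\Phi(H)$ ($I\in\mathfrak S_{\mathrm i}(H)$), $\mathrm{con}_{g,H}:\Phi(H)\to\Phi({}^gH)$ ($g\in G$) with $\mathrm{res}_{H,H}=\mathrm{ind}_{H,H}=\mathrm{con}_{1,H}=\mathrm{id}$;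 $\mathrm{res}_{J,I}\mathrm{res}_{I,H}=\mathrm{res}_{J,H}$, $\mathrm{ind}_{H,I}\mathrm{ind}_{I,J}=\mathrm{ind}_{H,J}$, $\mathrm{con}_{g',{}^gH}\mathrm{con}_{g,H}=\mathrm{con}_{g'g,H}$; $\mathrm{con}_{g,I}\mathrm{res}_{I,H}=\mathrm{res}_{{}^gI,{}^gH}\mathrm{con}_{g,H}$, $\mathrm{con}_{g,H}\mathrm{ind}_{H,I}=\mathrm{ind}_{{}^gH,{}^gI}\mathrm{con}_{g,I}$. It is stable if $\mathrm{con}_{h,H}=\mathrm{id}$ for all $h\in H$; cohomological if $\mathrm{ind}_{H,I}\mathrm{res}_{I,H}=[H:I]\cdot\mathrm{id}$ for $I\in\mathfrak S_{\mathrm r}(H)\cap\mathfrak S_{\mathrm i}(H)$. A Mackey functor is a stable RIC-functor on a Mackey system such that $\mathrm{res}_{I,H}\mathrm{ind}_{H,J}=\sum_{h}\mathrm{ind}_{I,I\cap{}^hJ}\,\mathrm{con}_{h,I^h\cap J}\,\mathrm{res}_{I^h\cap J,J}$ for $I\in\mathfrak M_{\mathrm r}(H)$, $J\in\mathfrak M_{\mathrm i}(H)$, $h$ running over representatives of $I\backslash H/J$. -}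

module Defs where

open import Level using (suc; Lift; lift; lower)
open import Algebra.Bundles using (Group; AbelianGroup)
open import Algebra.Morphism.Bundles using (GroupHomomorphism)
open import Data.Fin.Base using (Fin)
open import Data.Nat.Base using (ℕ)
open import Data.Product.Base using (Σ-syntax; ∃-syntax; _×_; _,_; proj₁; proj₂; uncurry)
open import Data.Product.Relation.Binary.Pointwise.NonDependent using (×-setoid)
open import Data.Unit.Polymorphic.Base using (⊤)
open import Function.Base using (_∘_)
open import Function.Bundles using (Bijection)
open import Relation.Binary.Bundles using (Setoid)
open import Relation.Binary.Core using (Rel)
open import Relation.Binary.Definitions using (_Respects_)
import Relation.Binary.PropositionalEquality.Properties as ≡
import Relation.Binary.Reasoning.Setoid as SetoidReasoning
open import Relation.Unary using (Pred; _∈_; _⊆_; _≐_; _∩_; ⋃; Satisfiable)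
import Algebra.Properties.CommutativeMonoid.Sum as Sum
import Algebra.Properties.Group as GroupProperties
import Algebra.Properties.AbelianGroup as AbelianGroupProperties
import Algebra.Properties.Monoid.Mult as Mult

-- Sets, their equalities and their subsets live at one level ℓ, while sets of
-- subsets live at level suc ℓ.

record Topology {ℓ} (X : Setoid ℓ ℓ) : Set (suc (suc ℓ)) where
  open Setoid X
  field
    Open           : Pred (Pred Carrier ℓ) (suc ℓ)
    open⇒respects  : ∀ {U} → Open U → U Respects _≈_
    whole-open     : Open (λ _ → ⊤)
    ∩-open         : ∀ {U V} → Open U → Open V → Open (U ∩ V)
    -- The union of a large family has values in Set (suc ℓ); the axiom
    -- concerns the subsets W that have the same elements.
    ⋃-open         : (I : Set (suc ℓ)) (V : I → Pred Carrier ℓ) →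
                     (∀ i → Open (V i)) →
                     ∀ {W} → W ≐ ⋃ I V → Open W

Continuous : ∀ {ℓ} {X Y : Setoid ℓ ℓ} → Topology X → Topology Y →
             (Setoid.Carrier X → Setoid.Carrier Y) → Set (suc ℓ)
Continuous τ σ f = ∀ {U} → Topology.Open σ U → Topology.Open τ (U ∘ f)

discreteTopology : ∀ {ℓ} (X : Setoid ℓ ℓ) → Topology X
discreteTopology {ℓ} X = record
  { Open          = λ U → Lift (suc ℓ) (U Respects _≈_)
  ; open⇒respects = lower
  ; whole-open    = lift (λ _ u → u)
  ; ∩-open        = λ (lift p) (lift q) →
                      lift (λ e (u , v) → p e u , q e v)
  ; ⋃-open        = λ I V o (W⊆ , ⊆W) → lift (λ e w →
                      let (i , v) = W⊆ w in ⊆W (i , lower (o i) e v))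
  }
  where open Setoid X

productTopology : ∀ {ℓ} {X Y : Setoid ℓ ℓ} → Topology X → Topology Y →
                  Topology (×-setoid X Y)
productTopology {ℓ} {X} {Y} τ σ = record
  { Open          = λ W → W Respects _≈_ ×
                      (∀ {x y} → (x , y) ∈ W →
                       Σ[ U ∈ Pred X.Carrier ℓ ] Σ[ V ∈ Pred Y.Carrier ℓ ]
                         τ.Open U × σ.Open V × x ∈ U × y ∈ V ×
                         (∀ {x′ y′} → x′ ∈ U → y′ ∈ V → (x′ , y′) ∈ W))
  ; open⇒respects = proj₁
  ; whole-open    = (λ _ w → w) , λ _ →
                      (λ _ → ⊤) , (λ _ → ⊤) , τ.whole-open , σ.whole-open , _ , _ , _
  ; ∩-open        = λ (r , p) (s , q) →
                      (λ e (u , v) → r e u , s e v) ,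
                      λ (w , w′) →
                        let (U  , V  , oU  , oV  , u  , v  , i ) = p w
                            (U′ , V′ , oU′ , oV′ , u′ , v′ , i′) = q w′
                        in U ∩ U′ , V ∩ V′ , τ.∩-open oU oU′ , σ.∩-open oV oV′ ,
                           (u , u′) , (v , v′) ,
                           λ (a , a′) (b , b′) → i a b , i′ a′ b′
  ; ⋃-open        = λ I Z o (W⊆ , ⊆W) →
                      (λ e w → let (k , z) = W⊆ w in ⊆W (k , proj₁ (o k) e z)) ,
                      λ w → let (k , z) = W⊆ w
                                (U , V , oU , oV , u , v , i) = proj₂ (o k) z
                            in U , V , oU , oV , u , v , λ a b → ⊆W (k , i a b)
  }
  where
  module X = Setoid X
  module Y = Setoid Y
  module τ = Topology τ
  module σ = Topology σ
  open Setoid (×-setoid X Y)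

record TopologicalGroup ℓ : Set (suc (suc ℓ)) where
  field
    group    : Group ℓ ℓ
  open Group group public
  field
    topology      : Topology setoid
    ∙-continuous  : Continuous (productTopology topology topology) topology (uncurry _∙_)
    ⁻¹-continuous : Continuous topology topology _⁻¹

record Module {ℓ} (G : Group ℓ ℓ) : Set (suc ℓ) where
  private module G = Group G
  infixr 8 _·_
  field
    abelianGroup : AbelianGroup ℓ ℓ
  open AbelianGroup abelianGroup public
    renaming (_∙_ to _+_; ε to 0#; _⁻¹ to -_)
  field
    _·_        : G.Carrier → Carrier → Carrier
    ·-cong     : ∀ {g g′ a a′} → g G.≈ g′ → a ≈ a′ → g · a ≈ g′ · a′
    ·-identity : ∀ a → G.ε · a ≈ a
    ·-assoc    : ∀ g g′ a → (g G.∙ g′) · a ≈ g · (g′ · a)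
    ·-distrib  : ∀ g a b → g · (a + b) ≈ g · a + g · b

record DiscreteModule {ℓ} (G : TopologicalGroup ℓ) : Set (suc ℓ) where
  private module G = TopologicalGroup G
  field
    module′ : Module G.group
  open Module module′ public
  field
    ·-continuous : Continuous (productTopology G.topology (discreteTopology setoid))
                              (discreteTopology setoid)
                              (uncurry _·_)

-- For a setoid S whose equality is an equivalence relation on a given set
-- (such as cosets below), these are the enumerations t₀, …, tₙ₋₁ of a complete
-- and irredundant system of representatives.
Representatives : ∀ {ℓ} → ℕ → Setoid ℓ ℓ → Set ℓ
Representatives n S = Bijection (≡.setoid (Fin n)) S

Finite : ∀ {ℓ} → Setoid ℓ ℓ → Set ℓ
Finite S = ∃[ n ] Representatives n S

module _ {ℓ} (G : Group ℓ ℓ) where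
  open Group G

  record Subgroup : Set (suc ℓ) where
    field
      members   : Pred Carrier ℓ
      respects  : members Respects _≈_
      ε-closed  : ε ∈ members
      ∙-closed  : ∀ {x y} → x ∈ members → y ∈ members → x ∙ y ∈ members
      ⁻¹-closed : ∀ {x} → x ∈ members → x ⁻¹ ∈ members

module Subgroups {ℓ} (G : Group ℓ ℓ) where
  open Group G
  open GroupProperties G using (⁻¹-anti-homo-∙; ε⁻¹≈ε; ⁻¹-involutive)
  open SetoidReasoning setoid
  open Subgroup

  infix 4 _∈ₛ_ _≤ₛ_ _≐ₛ_
  infixr 5 _∩ₛ_

  _∈ₛ_ : Carrier → Subgroup G → Set ℓ
  x ∈ₛ H = x ∈ members H

  _≤ₛ_ : Rel (Subgroup G) ℓ
  I ≤ₛ H = members I ⊆ members H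

  _≐ₛ_ : Rel (Subgroup G) ℓ
  H ≐ₛ H′ = members H ≐ members H′

  _∩ₛ_ : Subgroup G → Subgroup G → Subgroup G
  H ∩ₛ K = record
    { members   = members H ∩ members K
    ; respects  = λ e (h , k) → respects H e h , respects K e k
    ; ε-closed  = ε-closed H , ε-closed K
    ; ∙-closed  = λ (h , k) (h′ , k′) → ∙-closed H h h′ , ∙-closed K k k′
    ; ⁻¹-closed = λ (h , k) → ⁻¹-closed H h , ⁻¹-closed K k
    }

  conjugate : Carrier → Carrier → Carrier
  conjugate g x = g ∙ x ∙ g ⁻¹

  conjugate-cong : ∀ {g g′ x x′} → g ≈ g′ → x ≈ x′ → conjugate g x ≈ conjugate g′ x′
  conjugate-cong e f = ∙-cong (∙-cong e f) (⁻¹-cong e)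

  conjugate-ε : ∀ x → conjugate ε x ≈ x
  conjugate-ε x = begin
    ε ∙ x ∙ ε ⁻¹  ≈⟨ ∙-cong (identityˡ x) ε⁻¹≈ε ⟩
    x ∙ ε         ≈⟨ identityʳ x ⟩
    x             ∎

  conjugate-∙ : ∀ g g′ x → conjugate (g ∙ g′) x ≈ conjugate g (conjugate g′ x)
  conjugate-∙ g g′ x = begin
    g ∙ g′ ∙ x ∙ (g ∙ g′) ⁻¹       ≈⟨ ∙-cong (assoc g g′ x) (⁻¹-anti-homo-∙ g g′) ⟩
    g ∙ (g′ ∙ x) ∙ (g′ ⁻¹ ∙ g ⁻¹)  ≈⟨ assoc _ _ _ ⟨
    g ∙ (g′ ∙ x) ∙ g′ ⁻¹ ∙ g ⁻¹    ≈⟨ ∙-congʳ (assoc _ _ _) ⟩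
    g ∙ (g′ ∙ x ∙ g′ ⁻¹) ∙ g ⁻¹    ∎

  conjugate-inverseʳ : ∀ g x → conjugate g (conjugate (g ⁻¹) x) ≈ x
  conjugate-inverseʳ g x = begin
    conjugate g (conjugate (g ⁻¹) x)  ≈⟨ conjugate-∙ g (g ⁻¹) x ⟨
    conjugate (g ∙ g ⁻¹) x            ≈⟨ conjugate-cong (inverseʳ g) refl ⟩
    conjugate ε x                     ≈⟨ conjugate-ε x ⟩
    x                                 ∎

  conjugate-inverseˡ : ∀ g x → conjugate (g ⁻¹) (conjugate g x) ≈ x
  conjugate-inverseˡ g x = begin
    conjugate (g ⁻¹) (conjugate g x)  ≈⟨ conjugate-∙ (g ⁻¹) g x ⟨
    conjugate (g ⁻¹ ∙ g) x            ≈⟨ conjugate-cong (inverseˡ g) refl ⟩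
    conjugate ε x                     ≈⟨ conjugate-ε x ⟩
    x                                 ∎

  conjugate-homo : ∀ g x y → conjugate g (x ∙ y) ≈ conjugate g x ∙ conjugate g y
  conjugate-homo g x y = sym (begin
    g ∙ x ∙ g ⁻¹ ∙ (g ∙ y ∙ g ⁻¹)    ≈⟨ assoc _ _ _ ⟨
    g ∙ x ∙ g ⁻¹ ∙ (g ∙ y) ∙ g ⁻¹    ≈⟨ ∙-congʳ (assoc _ _ _) ⟩
    g ∙ x ∙ (g ⁻¹ ∙ (g ∙ y)) ∙ g ⁻¹  ≈⟨ ∙-congʳ (∙-congˡ (assoc _ _ _)) ⟨
    g ∙ x ∙ (g ⁻¹ ∙ g ∙ y) ∙ g ⁻¹    ≈⟨ ∙-congʳ (∙-congˡ (∙-congʳ (inverseˡ g))) ⟩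
    g ∙ x ∙ (ε ∙ y) ∙ g ⁻¹           ≈⟨ ∙-congʳ (∙-congˡ (identityˡ y)) ⟩
    g ∙ x ∙ y ∙ g ⁻¹                 ≈⟨ ∙-congʳ (assoc _ _ _) ⟩
    g ∙ (x ∙ y) ∙ g ⁻¹               ∎)

  conjugate-⁻¹ : ∀ g x → conjugate g (x ⁻¹) ≈ conjugate g x ⁻¹
  conjugate-⁻¹ g x = sym (begin
    (g ∙ x ∙ g ⁻¹) ⁻¹         ≈⟨ ⁻¹-anti-homo-∙ _ _ ⟩
    (g ⁻¹) ⁻¹ ∙ (g ∙ x) ⁻¹    ≈⟨ ∙-cong (⁻¹-involutive g) (⁻¹-anti-homo-∙ g x) ⟩
    g ∙ (x ⁻¹ ∙ g ⁻¹)         ≈⟨ assoc _ _ _ ⟨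
    g ∙ x ⁻¹ ∙ g ⁻¹           ∎)

  conjugate-1 : ∀ g → conjugate g ε ≈ ε
  conjugate-1 g = trans (∙-congʳ (identityʳ g)) (inverseʳ g)

  infixr 6 _▷_
  infixl 6 _◁_

  -- g ▷ H is gHg⁻¹, and H ◁ g is g⁻¹Hg.
  _▷_ : Carrier → Subgroup G → Subgroup G
  g ▷ H = record
    { members   = λ x → Σ[ h ∈ Carrier ] h ∈ₛ H × x ≈ g ∙ h ∙ g ⁻¹
    ; respects  = λ e (h , h∈ , eq) → h , h∈ , trans (sym e) eq
    ; ε-closed  = ε , ε-closed H , sym (conjugate-1 g)
    ; ∙-closed  = λ (h , h∈ , e) (k , k∈ , f) →
                    h ∙ k , ∙-closed H h∈ k∈ ,
                    trans (∙-cong e f) (sym (conjugate-homo g h k))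
    ; ⁻¹-closed = λ (h , h∈ , e) →
                    h ⁻¹ , ⁻¹-closed H h∈ ,
                    trans (⁻¹-cong e) (sym (conjugate-⁻¹ g h))
    }

  _◁_ : Subgroup G → Carrier → Subgroup G
  H ◁ g = g ⁻¹ ▷ H

  ▷-cong : ∀ {g g′} H H′ → g ≈ g′ → H ≐ₛ H′ → g ▷ H ≐ₛ g′ ▷ H′
  ▷-cong H H′ e (H⊆ , ⊆H) =
    (λ (h , h∈ , p) → h , H⊆ h∈ , trans p (conjugate-cong e refl)) ,
    (λ (h , h∈ , p) → h , ⊆H h∈ , trans p (conjugate-cong (sym e) refl))

  ▷-identity : ∀ H → ε ▷ H ≐ₛ H
  ▷-identity H =
    (λ (h , h∈ , p) → respects H (sym (trans p (conjugate-ε h))) h∈) ,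
    (λ {x} x∈ → x , x∈ , sym (conjugate-ε x))

  ▷-assoc : ∀ g′ g H → g′ ▷ (g ▷ H) ≐ₛ (g′ ∙ g) ▷ H
  ▷-assoc g′ g H =
    (λ (y , (h , h∈ , q) , p) →
       h , h∈ , trans p (trans (conjugate-cong refl q) (sym (conjugate-∙ g′ g h)))) ,
    (λ (h , h∈ , p) →
       conjugate g h , (h , h∈ , refl) , trans p (conjugate-∙ g′ g h))

  ▷-self : ∀ {h} H → h ∈ₛ H → h ▷ H ≐ₛ H
  ▷-self {h} H h∈ =
    (λ (k , k∈ , p) →
       respects H (sym p) (∙-closed H (∙-closed H h∈ k∈) (⁻¹-closed H h∈))) ,
    (λ {x} x∈ →
       conjugate (h ⁻¹) x ,
       ∙-closed H (∙-closed H (⁻¹-closed H h∈) x∈) (⁻¹-closed H (⁻¹-closed H h∈)) ,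
       sym (conjugate-inverseʳ h x))

  ▷-◁-∩ : ∀ h I J → h ▷ (I ◁ h ∩ₛ J) ≐ₛ I ∩ₛ h ▷ J
  ▷-◁-∩ h I J =
    (λ (y , ((i , i∈ , q) , y∈J) , p) →
       respects I (sym (trans p (trans (conjugate-cong refl q) (conjugate-inverseʳ h i)))) i∈ ,
       (y , y∈J , p)) ,
    (λ {x} (x∈I , (j , j∈ , p)) →
       j ,
       ((x , x∈I , sym (trans (conjugate-cong refl p) (conjugate-inverseˡ h j))) , j∈) , p)

  Elements : Subgroup G → Set ℓ
  Elements H = Σ[ x ∈ Carrier ] x ∈ₛ H

  infix 5 _/_ _＼_/_

  -- The left cosets xI of I in H
  _/_ : Subgroup G → Subgroup G → Setoid ℓ ℓ
  H / I = record
    { Carrier       = Elements H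
    ; _≈_           = λ (x , _) (y , _) → Σ[ i ∈ Carrier ] i ∈ₛ I × y ≈ x ∙ i
    ; isEquivalence = record
      { refl  = ε , ε-closed I , sym (identityʳ _)
      ; sym   = λ {(x , _)} {(y , _)} (i , i∈ , p) → i ⁻¹ , ⁻¹-closed I i∈ , (begin
          x                 ≈⟨ identityʳ x ⟨
          x ∙ ε             ≈⟨ ∙-congˡ (inverseʳ i) ⟨
          x ∙ (i ∙ i ⁻¹)    ≈⟨ assoc _ _ _ ⟨
          x ∙ i ∙ i ⁻¹      ≈⟨ ∙-congʳ p ⟨
          y ∙ i ⁻¹          ∎)
      ; trans = λ (i , i∈ , p) (k , k∈ , q) →
          i ∙ k , ∙-closed I i∈ k∈ , trans q (trans (∙-congʳ p) (assoc _ _ _))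
      }
    }

  -- The double cosets IxJ in H
  _＼_/_ : Subgroup G → Subgroup G → Subgroup G → Setoid ℓ ℓ
  I ＼ H / J = record
    { Carrier       = Elements H
    ; _≈_           = λ (x , _) (y , _) →
                        Σ[ i ∈ Carrier ] Σ[ j ∈ Carrier ] i ∈ₛ I × j ∈ₛ J × y ≈ i ∙ x ∙ j
    ; isEquivalence = record
      { refl  = ε , ε , ε-closed I , ε-closed J ,
                sym (trans (identityʳ _) (identityˡ _))
      ; sym   = λ {(x , _)} {(y , _)} (i , j , i∈ , j∈ , p) →
          i ⁻¹ , j ⁻¹ , ⁻¹-closed I i∈ , ⁻¹-closed J j∈ , (begin
            x                              ≈⟨ identityˡ x ⟨
            ε ∙ x                          ≈⟨ ∙-congʳ (inverseˡ i) ⟨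
            i ⁻¹ ∙ i ∙ x                   ≈⟨ assoc _ _ _ ⟩
            i ⁻¹ ∙ (i ∙ x)                 ≈⟨ identityʳ _ ⟨
            i ⁻¹ ∙ (i ∙ x) ∙ ε             ≈⟨ ∙-congˡ (inverseʳ j) ⟨
            i ⁻¹ ∙ (i ∙ x) ∙ (j ∙ j ⁻¹)    ≈⟨ assoc _ _ _ ⟨
            i ⁻¹ ∙ (i ∙ x) ∙ j ∙ j ⁻¹      ≈⟨ ∙-congʳ (assoc _ _ _) ⟩
            i ⁻¹ ∙ (i ∙ x ∙ j) ∙ j ⁻¹      ≈⟨ ∙-congʳ (∙-congˡ p) ⟨
            i ⁻¹ ∙ y ∙ j ⁻¹                ∎)
      ; trans = λ {(x , _)} {(y , _)} {(z , _)} (i , j , i∈ , j∈ , p) (k , l , k∈ , l∈ , q) →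
          k ∙ i , j ∙ l , ∙-closed I k∈ i∈ , ∙-closed J j∈ l∈ , (begin
            z                              ≈⟨ q ⟩
            k ∙ y ∙ l                      ≈⟨ ∙-congʳ (∙-congˡ p) ⟩
            k ∙ (i ∙ x ∙ j) ∙ l            ≈⟨ ∙-congʳ (assoc _ _ _) ⟨
            k ∙ (i ∙ x) ∙ j ∙ l            ≈⟨ assoc _ _ _ ⟩
            k ∙ (i ∙ x) ∙ (j ∙ l)          ≈⟨ ∙-congʳ (assoc _ _ _) ⟨
            k ∙ i ∙ x ∙ (j ∙ l)            ∎)
      }
    }

  LeftTransversal : ℕ → Subgroup G → Subgroup G → Set ℓ
  LeftTransversal n H I = Representatives n (H / I)

  HasIndex : Subgroup G → Subgroup G → ℕ → Set ℓ
  HasIndex H I n = Representatives n (H / I)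

module _ {ℓ} (G : Group ℓ ℓ) where
  open Group G using (Carrier)
  open Subgroups G

  record ConjugationClosedSet : Set (suc (suc ℓ)) where
    field
      𝔖ᵇ       : Pred (Subgroup G) (suc ℓ)
      respects : 𝔖ᵇ Respects _≐ₛ_
      nonempty : Satisfiable 𝔖ᵇ
      conj     : ∀ g {H} → H ∈ 𝔖ᵇ → g ▷ H ∈ 𝔖ᵇ

    Base : Set (suc ℓ)
    Base = Σ[ H ∈ Subgroup G ] H ∈ 𝔖ᵇ

    infixr 6 _▷ᵇ_
    _▷ᵇ_ : Carrier → Base → Base
    g ▷ᵇ (H , H∈) = g ▷ H , conj g H∈

    infix 4 _≐ᵇ_
    _≐ᵇ_ : Rel Base ℓ
    (H , _) ≐ᵇ (H′ , _) = H ≐ₛ H′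

  -- One of the two families 𝔖⋆(H), ⋆ ∈ {r, i}
  record SubgroupFamily (B : ConjugationClosedSet) : Set (suc (suc ℓ)) where
    open ConjugationClosedSet B hiding (respects; conj)
    infix 4 _∈⋆_
    field
      -- I ∈⋆ H stands for I ∈ 𝔖⋆(H).
      _∈⋆_     : Rel Base (suc ℓ)
      respects : ∀ {I I′ H H′} → I ≐ᵇ I′ → H ≐ᵇ H′ → I ∈⋆ H → I′ ∈⋆ H′
      ∈⋆⇒≤     : ∀ {I H} → I ∈⋆ H → proj₁ I ≤ₛ proj₁ H
      self     : ∀ H → H ∈⋆ H
      tower    : ∀ {J I H} → J ∈⋆ I → I ∈⋆ H → J ∈⋆ H
      -- The two inclusions of {gIg⁻¹ | I ∈ 𝔖⋆(H)} = 𝔖⋆(gHg⁻¹)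
      conj     : ∀ g {I H} → I ∈⋆ H → g ▷ᵇ I ∈⋆ g ▷ᵇ H
      conj⁻¹   : ∀ g {K H} → K ∈⋆ g ▷ᵇ H → Σ[ I ∈ Base ] (I ∈⋆ H × K ≐ᵇ g ▷ᵇ I)

  record SubgroupSystem : Set (suc (suc ℓ)) where
    field
      base        : ConjugationClosedSet
      restriction : SubgroupFamily base
      induction   : SubgroupFamily base
    open ConjugationClosedSet base public using (𝔖ᵇ; Base; _▷ᵇ_; _≐ᵇ_)
    module b = ConjugationClosedSet base
    module r = SubgroupFamily restriction
    module i = SubgroupFamily induction
    open r public using () renaming (_∈⋆_ to _∈ʳ_)
    open i public using () renaming (_∈⋆_ to _∈ⁱ_)

module _ {ℓ} {G : Group ℓ ℓ} (𝔖 : SubgroupSystem G) where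
  open Group G using (Carrier; _⁻¹)
  open Subgroups G
  open SubgroupSystem 𝔖

  IFinite : Set (suc ℓ)
  IFinite = ∀ {H I} → I ∈ⁱ H → Finite (proj₁ H / proj₁ I)

  record IsMackeySystem : Set (suc ℓ) where
    field
      finite : ∀ {H I J} → I ∈ʳ H → J ∈ⁱ H → Finite (proj₁ I ＼ proj₁ H / proj₁ J)
      ∩-base : ∀ {H I J} → I ∈ʳ H → J ∈ⁱ H → proj₁ I ∩ₛ proj₁ J ∈ 𝔖ᵇ
      ∩-res  : ∀ {H I J} (m : I ∈ʳ H) (n : J ∈ⁱ H) → (_ , ∩-base m n) ∈ʳ J
      ∩-ind  : ∀ {H I J} (m : I ∈ʳ H) (n : J ∈ⁱ H) → (_ , ∩-base m n) ∈ⁱ I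

    ▷-ind : ∀ {H J h} → h ∈ₛ proj₁ H → J ∈ⁱ H → h ▷ᵇ J ∈ⁱ H
    ▷-ind {H} {J} {h} h∈ n =
      i.respects {I = h ▷ᵇ J} {H = h ▷ᵇ H} ((λ x → x) , (λ x → x))
                 (▷-self (proj₁ H) h∈) (i.conj h n)

    ◁-res : ∀ {H I h} → h ∈ₛ proj₁ H → I ∈ʳ H → h ⁻¹ ▷ᵇ I ∈ʳ H
    ◁-res {H} {I} {h} h∈ m =
      r.respects {I = h ⁻¹ ▷ᵇ I} {H = h ⁻¹ ▷ᵇ H} ((λ x → x) , (λ x → x))
                 (▷-self (proj₁ H) (Subgroup.⁻¹-closed (proj₁ H) h∈)) (r.conj (h ⁻¹) m)

Hom : ∀ {ℓ} → AbelianGroup ℓ ℓ → AbelianGroup ℓ ℓ → Set ℓ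
Hom A B = GroupHomomorphism (AbelianGroup.rawGroup A) (AbelianGroup.rawGroup B)

open GroupHomomorphism public using () renaming (⟦_⟧ to infixr 20 _⟨$⟩_)

-- An assignment H ↦ Φ(H). Equal subgroups need not be identical terms, so the
-- identification of Φ(H) with Φ(H′) for H = H′ is part of the data; by cast-refl
-- and cast-trans it does not depend on the proof of H = H′.
record Objects {ℓ} {G : Group ℓ ℓ} (𝔖 : SubgroupSystem G) : Set (suc ℓ) where
  open SubgroupSystem 𝔖
  field
    obj  : Base → AbelianGroup ℓ ℓ
    cast : ∀ H H′ → H ≐ᵇ H′ → Hom (obj H) (obj H′)

  ∣_∣ : Base → Set ℓ
  ∣ H ∣ = AbelianGroup.Carrier (obj H)

  Equal : ∀ H → Rel ∣ H ∣ ℓ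
  Equal H = AbelianGroup._≈_ (obj H)

  infix 4 Equal
  syntax Equal H x y = x ≈[ H ] y

  field
    cast-refl  : ∀ H (e : H ≐ᵇ H) x → cast H H e ⟨$⟩ x ≈[ H ] x
    cast-trans : ∀ H H′ H″ (e : H ≐ᵇ H′) (f : H′ ≐ᵇ H″) (g : H ≐ᵇ H″) x →
                 cast H′ H″ f ⟨$⟩ cast H H′ e ⟨$⟩ x ≈[ H″ ] cast H H″ g ⟨$⟩ x

-- The RIC-functors with the given values on objects. The first three laws say that
-- res, ind and con depend on the subgroups only up to equality.
record RICStructure {ℓ} {G : Group ℓ ℓ} {𝔖 : SubgroupSystem G} (Φ : Objects 𝔖) : Set (suc ℓ) where
  open Group G using (Carrier; _≈_; _∙_; ε)
  open Subgroups G
  open SubgroupSystem 𝔖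
  open Objects Φ
  field
    res : ∀ {I H} → I ∈ʳ H → Hom (obj H) (obj I)
    ind : ∀ {H I} → I ∈ⁱ H → Hom (obj I) (obj H)
    con : ∀ g H → Hom (obj H) (obj (g ▷ᵇ H))

    res-cong : ∀ {I I′ H H′} (e : I ≐ᵇ I′) (f : H ≐ᵇ H′) (m : I ∈ʳ H) (m′ : I′ ∈ʳ H′) x →
               res m′ ⟨$⟩ cast H H′ f ⟨$⟩ x ≈[ I′ ] cast I I′ e ⟨$⟩ res m ⟨$⟩ x
    ind-cong : ∀ {I I′ H H′} (e : I ≐ᵇ I′) (f : H ≐ᵇ H′) (m : I ∈ⁱ H) (m′ : I′ ∈ⁱ H′) x →
               ind m′ ⟨$⟩ cast I I′ e ⟨$⟩ x ≈[ H′ ] cast H H′ f ⟨$⟩ ind m ⟨$⟩ x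
    con-cong : ∀ {g g′} (p : g ≈ g′) H H′ (e : H ≐ᵇ H′) x →
               con g′ H′ ⟨$⟩ cast H H′ e ⟨$⟩ x
                 ≈[ g′ ▷ᵇ H′ ]
               cast (g ▷ᵇ H) (g′ ▷ᵇ H′) (▷-cong (proj₁ H) (proj₁ H′) p e) ⟨$⟩ con g H ⟨$⟩ x

    res-id : ∀ H x → res (r.self H) ⟨$⟩ x ≈[ H ] x
    ind-id : ∀ H x → ind (i.self H) ⟨$⟩ x ≈[ H ] x
    con-id : ∀ H x → cast (ε ▷ᵇ H) H (▷-identity (proj₁ H)) ⟨$⟩ con ε H ⟨$⟩ x ≈[ H ] x

    res-res : ∀ {J I H} (m : J ∈ʳ I) (n : I ∈ʳ H) x →
              res m ⟨$⟩ res n ⟨$⟩ x ≈[ J ] res (r.tower m n) ⟨$⟩ x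
    ind-ind : ∀ {J I H} (m : J ∈ⁱ I) (n : I ∈ⁱ H) x →
              ind n ⟨$⟩ ind m ⟨$⟩ x ≈[ H ] ind (i.tower m n) ⟨$⟩ x
    con-con : ∀ g′ g H x →
              cast (g′ ▷ᵇ (g ▷ᵇ H)) ((g′ ∙ g) ▷ᵇ H) (▷-assoc g′ g (proj₁ H))
                ⟨$⟩ con g′ (g ▷ᵇ H) ⟨$⟩ con g H ⟨$⟩ x
                ≈[ (g′ ∙ g) ▷ᵇ H ]
              con (g′ ∙ g) H ⟨$⟩ x

    con-res : ∀ g {I H} (m : I ∈ʳ H) x →
              con g I ⟨$⟩ res m ⟨$⟩ x ≈[ g ▷ᵇ I ] res (r.conj g m) ⟨$⟩ con g H ⟨$⟩ x
    con-ind : ∀ g {I H} (m : I ∈ⁱ H) x →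
              con g H ⟨$⟩ ind m ⟨$⟩ x ≈[ g ▷ᵇ H ] ind (i.conj g m) ⟨$⟩ con g I ⟨$⟩ x

module _ {ℓ} {G : Group ℓ ℓ} {𝔖 : SubgroupSystem G} {Φ : Objects 𝔖} (F : RICStructure Φ) where
  open Group G using (_⁻¹)
  open Subgroups G
  open SubgroupSystem 𝔖
  open Objects Φ
  open RICStructure F

  IsStable : Set (suc ℓ)
  IsStable = ∀ H h (h∈ : h ∈ₛ proj₁ H) x →
    cast (h ▷ᵇ H) H (▷-self (proj₁ H) h∈) ⟨$⟩ con h H ⟨$⟩ x ≈[ H ] x

  -- [H : I] is required to be finite, so that multiplication by it makes sense.
  IsCohomological : Set (suc ℓ)
  IsCohomological = ∀ {I H} (m : I ∈ʳ H) (n : I ∈ⁱ H) →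
    Σ[ k ∈ ℕ ] HasIndex (proj₁ H) (proj₁ I) k ×
      (let open Mult (AbelianGroup.monoid (obj H)) renaming (_×_ to _×ₘ_) in
       ∀ x → ind n ⟨$⟩ res m ⟨$⟩ x ≈[ H ] k ×ₘ x)

  module _ (M : IsMackeySystem 𝔖) where
    open IsMackeySystem M

    mackeySummand : ∀ {H I J} → I ∈ʳ H → J ∈ⁱ H → Elements (proj₁ H) → ∣ J ∣ → ∣ I ∣
    mackeySummand {H} {I} {J} m n (h , h∈) x =
      ind (∩-ind m n′)
        ⟨$⟩ cast (h ▷ᵇ Iʰ∩J) I∩ʰJ (▷-◁-∩ h (proj₁ I) (proj₁ J))
        ⟨$⟩ con h Iʰ∩J
        ⟨$⟩ res (∩-res m′ n)
        ⟨$⟩ x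
      where
      m′ : h ⁻¹ ▷ᵇ I ∈ʳ H
      m′ = ◁-res h∈ m
      n′ : h ▷ᵇ J ∈ⁱ H
      n′ = ▷-ind h∈ n
      Iʰ∩J I∩ʰJ : Base
      Iʰ∩J = proj₁ I ◁ h ∩ₛ proj₁ J , ∩-base m′ n
      I∩ʰJ = proj₁ I ∩ₛ h ▷ proj₁ J , ∩-base m n′

    record IsMackeyFunctor : Set (suc ℓ) where
      field
        stable        : IsStable
        mackeyFormula : ∀ {H I J} (m : I ∈ʳ H) (n : J ∈ⁱ H)
          {k} (R : Representatives k (proj₁ I ＼ proj₁ H / proj₁ J)) x →
          let open Sum (AbelianGroup.commutativeMonoid (obj I)) using (sum) in
          res m ⟨$⟩ ind n ⟨$⟩ x
            ≈[ I ]
          sum (λ j → mackeySummand m n (Bijection.to R j) x)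

module _ {ℓ} {G : Group ℓ ℓ} (A : Module G) where
  open Module A
  open Subgroups G
  open AbelianGroupProperties abelianGroup using (inverseˡ-unique; identityˡ-unique)

  ·-zero : ∀ g → g · 0# ≈ 0#
  ·-zero g = identityˡ-unique _ _
    (trans (sym (·-distrib g 0# 0#)) (·-cong (Group.refl G) (identityˡ 0#)))

  ·-neg : ∀ g a → g · (- a) ≈ - (g · a)
  ·-neg g a = inverseˡ-unique _ _
    (trans (sym (·-distrib g (- a) a))
      (trans (·-cong (Group.refl G) (inverseˡ a)) (·-zero g)))

  invariants : Subgroup G → AbelianGroup ℓ ℓ
  invariants H = record
    { Carrier = Σ[ a ∈ Carrier ] (∀ h → h ∈ₛ H → h · a ≈ a)
    ; _≈_     = λ (a , _) (b , _) → a ≈ b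
    ; _∙_     = λ (a , p) (b , q) →
                  a + b , λ h h∈ → trans (·-distrib h a b) (∙-cong (p h h∈) (q h h∈))
    ; ε       = 0# , λ h _ → ·-zero h
    ; _⁻¹     = λ (a , p) → - a , λ h h∈ → trans (·-neg h a) (⁻¹-cong (p h h∈))
    ; isAbelianGroup = record
      { isGroup = record
        { isMonoid = record
          { isSemigroup = record
            { isMagma = record
              { isEquivalence = record { refl = refl ; sym = sym ; trans = trans }
              ; ∙-cong = ∙-cong
              }
            ; assoc = λ _ _ _ → assoc _ _ _
            }
          ; identity = (λ _ → identityˡ _) , (λ _ → identityʳ _)
          }
        ; inverse = (λ _ → inverseˡ _) , (λ _ → inverseʳ _)
        ; ⁻¹-cong = ⁻¹-cong
        }
      ; comm = λ _ _ → comm _ _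
      }
    }

  invariantObjects : (𝔖 : SubgroupSystem G) → Objects 𝔖
  invariantObjects 𝔖 = record
    { obj        = λ H → invariants (proj₁ H)
    ; cast       = λ H H′ e → record
      { ⟦_⟧ = λ (a , p) → a , λ h h∈ → p h (proj₂ e h∈)
      ; isGroupHomomorphism = record
        { isMonoidHomomorphism = record
          { isMagmaHomomorphism = record
            { isRelHomomorphism = record { cong = λ e → e }
            ; homo              = λ _ _ → refl
            }
          ; ε-homo = refl
          }
        ; ⁻¹-homo = λ _ → refl
        }
      }
    ; cast-refl  = λ _ _ _ → refl
    ; cast-trans = λ _ _ _ _ _ _ _ → refl
    }

  record IsH⁰ {𝔖 : SubgroupSystem G} (F : RICStructure (invariantObjects 𝔖)) : Set (suc ℓ) where
    open SubgroupSystem 𝔖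
    open RICStructure F
    open Sum commutativeMonoid using (sum)
    field
      res-inclusion : ∀ {I H} (m : I ∈ʳ H) a → proj₁ (res m ⟨$⟩ a) ≈ proj₁ a
      ind-sum       : ∀ {H I} (m : I ∈ⁱ H) {n} (T : LeftTransversal n (proj₁ H) (proj₁ I)) a →
                      proj₁ (ind m ⟨$⟩ a) ≈ sum (λ k → proj₁ (Bijection.to T k) · proj₁ a)
      con-action    : ∀ g H a → proj₁ (con g H ⟨$⟩ a) ≈ g · proj₁ a

{-# OPTIONS --safe #-}

-- For a ∈ A^I the map x ↦ xa is constant on the left cosets xI, so the sum defining
-- ind_{H,I} is a sum over H/I and does not depend on the transversal. Each law for ind
-- then compares transversals: hT for the invariance of ind a, gTg⁻¹ for the compatibility
-- with conjugation, the products st for transitivity, and, for the Mackey formula, the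
-- elements th, where h represents I\H/J and t runs over a transversal of I ∩ hJh⁻¹ in I.

module Submission where

open import Algebra.Bundles using (Group; AbelianGroup; CommutativeMonoid)
import Algebra.Properties.CommutativeMonoid.Sum as Sum
import Algebra.Properties.Group as GroupProperties
import Algebra.Properties.Monoid.Mult as Mult
open import Data.Bool.Base using (if_then_else_)
open import Data.Fin.Base using (Fin; zero; suc; punchIn)
open import Data.Fin.Properties using (_≟_; punchInᵢ≢i)
open import Data.Nat.Base using (ℕ; zero; suc)
open import Data.Product.Base using (Σ-syntax; ∃₂; _×_; _,_; proj₁; proj₂)
open import Function.Base using (_∘_)
open import Function.Bundles using (Bijection)
open import Function.Consequences.Setoid using (strictlySurjective⇒surjective)
open import Function.Definitions using (Congruent; Injective; StrictlySurjective)
import Function.Construct.Composition as Composition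
import Function.Construct.Symmetry as Symmetry
open import Function.Properties.Bijection using (Bijection⇒Inverse)
open import Relation.Binary.Bundles using (Setoid)
open import Relation.Binary.PropositionalEquality.Core as ≡ using (_≡_; _≢_)
import Relation.Binary.PropositionalEquality.Properties as ≡
import Relation.Binary.Reasoning.Setoid as SetoidReasoning
open import Relation.Nullary.Decidable using (does; dec-true; dec-false)
open import Defs

-- Bijections between setoids.

mkBijection : ∀ {a b ℓ₁ ℓ₂} (S : Setoid a ℓ₁) (S′ : Setoid b ℓ₂) →
              let open Setoid S using () renaming (_≈_ to _≈₁_)
                  open Setoid S′ using () renaming (_≈_ to _≈₂_) in
              (f : Setoid.Carrier S → Setoid.Carrier S′) →
              Congruent _≈₁_ _≈₂_ f → Injective _≈₁_ _≈₂_ f →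
              StrictlySurjective _≈₂_ f → Bijection S S′
mkBijection S S′ f f-cong f-inj f-surj = record
  { to        = f
  ; cong      = f-cong
  ; bijective = f-inj , strictlySurjective⇒surjective S S′ f-cong f-surj
  }

-- Finite sums in a commutative monoid.

module FiniteSums {c ℓ} (M : CommutativeMonoid c ℓ) where
  open CommutativeMonoid M renaming (_∙_ to _+_; ε to 0#)
  open Sum M
  open SetoidReasoning setoid

  sum-zero : ∀ {n} (t : Fin n → Carrier) → (∀ j → t j ≈ 0#) → sum t ≈ 0#
  sum-zero {n} t t≈0 = trans (sum-cong-≋ t≈0) (sum-replicate-zero n)

  sum-supported : ∀ {n} (t : Fin n → Carrier) i → (∀ j → j ≢ i → t j ≈ 0#) → sum t ≈ t i
  sum-supported {suc n} t i t≈0 = begin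
    sum t                       ≈⟨ sum-remove {i = i} t ⟩
    t i + sum (t ∘ punchIn i)   ≈⟨ ∙-congˡ (sum-zero _ (λ j → t≈0 _ (punchInᵢ≢i i j))) ⟩
    t i + 0#                    ≈⟨ identityʳ (t i) ⟩
    t i                         ∎

  -- A Kronecker delta with value `x`. It extends a sum over some indices by zeros to all of them,
  -- so that regrouping terms becomes an interchange of finite sums.
  δ : ∀ {n} → Fin n → Fin n → Carrier → Carrier
  δ i j x = if does (i ≟ j) then x else 0#

  δ-refl : ∀ {n} (i : Fin n) x → δ i i x ≈ x
  δ-refl i x = reflexive (≡.cong (if_then x else 0#) (dec-true (i ≟ i) ≡.refl))

  δ-≢ : ∀ {n} (i j : Fin n) → i ≢ j → ∀ x → δ i j x ≈ 0#
  δ-≢ i j i≢j x = reflexive (≡.cong (if_then x else 0#) (dec-false (i ≟ j) i≢j))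

  sum-δ : ∀ {n} (f : Fin n → Carrier) i → sum (λ j → δ i j (f j)) ≈ f i
  sum-δ f i = trans (sum-supported _ i (λ j j≢i → δ-≢ i j (j≢i ∘ ≡.sym) (f j))) (δ-refl i (f i))

  -- Both sides equal the sum over all i, l, j of f j restricted to e i l ≡ j.
  sum-partition : ∀ {n k} {m : Fin n → ℕ} (e : ∀ i → Fin (m i) → Fin k) →
                  (∀ {i i′ l l′} → e i l ≡ e i′ l′ → i ≡ i′) →
                  (∀ i {l l′} → e i l ≡ e i l′ → l ≡ l′) →
                  (∀ j → ∃₂ λ i l → e i l ≡ j) →
                  ∀ f → sum (λ i → sum (λ l → f (e i l))) ≈ sum f
  sum-partition {n} {k} {m} e disjoint inj surj f = begin
    sum (λ i → sum (λ l → f (e i l)))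
      ≈⟨ sum-cong-≋ (λ i → sum-cong-≋ (λ l → sum-δ f (e i l))) ⟨
    sum (λ i → sum (λ l → sum (λ j → δ (e i l) j (f j))))
      ≈⟨ sum-cong-≋ (λ i → ∑-comm {m i} {k} _) ⟩
    sum (λ i → sum (λ j → sum (λ l → δ (e i l) j (f j))))
      ≈⟨ ∑-comm {n} {k} _ ⟩
    sum (λ j → sum (λ i → sum (λ l → δ (e i l) j (f j))))
      ≈⟨ sum-cong-≋ fibre ⟩
    sum f ∎
    where
    fibre : ∀ j → sum (λ i → sum (λ l → δ (e i l) j (f j))) ≈ f j
    fibre j with surj j
    -- Only the term at the preimage (i, l) of `j` survives: `disjoint` kills the rows i′ ≠ i, and
    -- `inj` the other entries of row i.
    ... | i , l , ≡.refl = begin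
      sum (λ i′ → sum (λ l′ → δ (e i′ l′) j (f j)))
        ≈⟨ sum-supported _ i (λ i′ i′≢i → sum-zero (λ l′ → δ (e i′ l′) j (f j))
             (λ l′ → δ-≢ (e i′ l′) j (i′≢i ∘ disjoint) (f j))) ⟩
      sum (λ l′ → δ (e i l′) j (f j))
        ≈⟨ sum-supported _ l (λ l′ l′≢l → δ-≢ (e i l′) j (l′≢l ∘ inj i) (f j)) ⟩
      δ (e i l) j (f j)
        ≈⟨ δ-refl j (f j) ⟩
      f j ∎

  module _ {s} {S : Setoid s s} (f : Setoid.Carrier S → Carrier)
           (f-cong : Congruent (Setoid._≈_ S) _≈_ f) where
    private module S = Setoid S

    -- Sending an index of `T′` to the index of the same class in `T` is a permutation, even though
    -- the lengths m and n are a priori different. The terms then agree because `f` is constant on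
    -- classes.
    sum-representatives : ∀ {m n} (T : Representatives m S) (T′ : Representatives n S) →
                          sum (f ∘ Bijection.to T) ≈ sum (f ∘ Bijection.to T′)
    sum-representatives T T′ = trans
      (sum-permute (f ∘ Bijection.to T)
        (Composition.inverse (Bijection⇒Inverse T′) (Symmetry.inverse (Bijection⇒Inverse T))))
      (sum-cong-≋ (λ j → f-cong (proj₂ (Bijection.strictlySurjective T (Bijection.to T′ j)))))

    -- The hypotheses say that the family `u` meets every class exactly once. Injectivity is split
    -- in two because l and l′ have a common type only once i and i′ agree. Replacing each `u i l`
    -- by the index of its class in `T` reduces the claim to `sum-partition`.
    sum-representatives-partition :
      ∀ {k n} {m : Fin n → ℕ} (T : Representatives k S) (u : ∀ i → Fin (m i) → S.Carrier) →
      (∀ {i i′ l l′} → u i l S.≈ u i′ l′ → i ≡ i′) →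
      (∀ i {l l′} → u i l S.≈ u i l′ → l ≡ l′) →
      (∀ x → ∃₂ λ i l → u i l S.≈ x) →
      sum (λ i → sum (λ l → f (u i l))) ≈ sum (f ∘ Bijection.to T)
    sum-representatives-partition {m = m} T u disjoint inj surj = trans
      (sum-cong-≋ (λ i → sum-cong-≋ (λ l → f-cong (S.sym (to-e i l)))))
      (sum-partition e (disjoint ∘ e⇒u) (λ i → inj i ∘ e⇒u)
        (λ j → let i , l , u≈Tj = surj (Bijection.to T j) in
               i , l , Bijection.injective T (S.trans (to-e i l) u≈Tj))
        (f ∘ Bijection.to T))
      where
      e : ∀ i → Fin (m i) → _
      e i l = Bijection.to⁻ T (u i l)

      to-e : ∀ i l → Bijection.to T (e i l) S.≈ u i l
      to-e i l = proj₂ (Bijection.strictlySurjective T (u i l))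

      e⇒u : ∀ {i i′ l l′} → e i l ≡ e i′ l′ → u i l S.≈ u i′ l′
      e⇒u {i} {i′} {l} {l′} eq =
        S.trans (S.sym (to-e i l)) (S.trans (Bijection.cong T eq) (to-e i′ l′))

-- Cosets and transversals.

module Cosets {ℓ} (G : Group ℓ ℓ) where
  open Group G
  open GroupProperties G
  open Subgroups G
  open Subgroup
  open SetoidReasoning setoid

  -- Left multiplication commutes with the right multiplication that identifies the elements of a
  -- coset, so the same `i` witnesses the equality of cosets before and after.
  translation : ∀ H I {h} → h ∈ₛ H → Bijection (H / I) (H / I)
  translation H I {h} h∈ = mkBijection (H / I) (H / I)
    (λ (x , x∈) → h ∙ x , ∙-closed H h∈ x∈)
    (λ (i , i∈ , p) → i , i∈ , trans (∙-congˡ p) (sym (assoc _ _ _)))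
    (λ (i , i∈ , p) → i , i∈ , ∙-cancelˡ h _ _ (trans p (assoc _ _ _)))
    (λ (y , y∈) → (h \\ y , ∙-closed H (⁻¹-closed H h∈) y∈) ,
                  ε , ε-closed I , sym (trans (identityʳ _) (\\-leftDividesˡ h y)))

  conjugation : ∀ g H I → Bijection (H / I) (g ▷ H / g ▷ I)
  conjugation g H I = mkBijection (H / I) (g ▷ H / g ▷ I)
    (λ (x , x∈) → conjugate g x , x , x∈ , refl)
    (λ (i , i∈ , p) → conjugate g i , (i , i∈ , refl) ,
                      trans (conjugate-cong refl p) (conjugate-homo g _ i))
    (λ (_ , (i , i∈ , q) , p) → i , i∈ , conjugate-injective g
                      (trans p (trans (∙-congˡ q) (sym (conjugate-homo g _ i)))))
    (λ (y , x , x∈ , p) → (x , x∈) , ε , ε-closed (g ▷ I) , trans p (sym (identityʳ _)))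
    where
    conjugate-injective : ∀ g {x y} → conjugate g x ≈ conjugate g y → x ≈ y
    conjugate-injective g p = ∙-cancelˡ g _ _ (∙-cancelʳ (g ⁻¹) _ _ p)

  /-cong : ∀ {H H′ I I′} → H ≐ₛ H′ → I ≐ₛ I′ → Bijection (H / I) (H′ / I′)
  /-cong {H} {H′} {I} {I′} (H⊆ , ⊆H) (I⊆ , ⊆I) = mkBijection (H / I) (H′ / I′)
    (λ (x , x∈) → x , H⊆ x∈)
    (λ (i , i∈ , p) → i , I⊆ i∈ , p)
    (λ (i , i∈ , p) → i , ⊆I i∈ , p)
    (λ (y , y∈) → (y , ⊆H y∈) , ε , ε-closed I′ , sym (identityʳ y))

  trivialTransversal : ∀ H → LeftTransversal 1 H H
  trivialTransversal H = mkBijection (≡.setoid (Fin 1)) (H / H)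
    (λ _ → ε , ε-closed H)
    (λ _ → Setoid.refl (H / H) {ε , ε-closed H})
    (λ { {zero} {zero} _ → ≡.refl })
    (λ (y , y∈) → zero , y , y∈ , sym (identityˡ y))

  -- Transversals in a tower J ≤ I ≤ H.

  module Tower {J I H : Subgroup G} (J≤I : J ≤ₛ I) (I≤H : I ≤ₛ H)
               {m n} (S : LeftTransversal n H I) (T : LeftTransversal m I J) where
    private
      module S = Bijection S
      module T = Bijection T

    product : Fin n → Fin m → Elements H
    product i l = let s , s∈ = S.to i ; t , t∈ = T.to l in s ∙ t , ∙-closed H s∈ (I≤H t∈)

    open Setoid (H / J) using () renaming (_≈_ to _~_)

    -- As J ≤ I, an equation s′t′ = stj places s′ in the coset sI, which `S` meets only once.
    product-disjoint : ∀ {i i′ l l′} → product i l ~ product i′ l′ → i ≡ i′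
    product-disjoint {i} {i′} {l} {l′} (j , j∈ , p) =
      let s , _ = S.to i ; s′ , _ = S.to i′ ; t , t∈ = T.to l ; t′ , t′∈ = T.to l′ in
      S.injective
        ( t ∙ j // t′
        , ∙-closed I (∙-closed I t∈ (J≤I j∈)) (⁻¹-closed I t′∈)
        , (begin
            s′                    ≈⟨ x≈z//y s′ t′ _ p ⟩
            s ∙ t ∙ j // t′       ≈⟨ ∙-congʳ (assoc s t j) ⟩
            s ∙ (t ∙ j) // t′     ≈⟨ assoc _ _ _ ⟩
            s ∙ (t ∙ j // t′)     ∎))

    product-injective : ∀ i {l l′} → product i l ~ product i l′ → l ≡ l′
    product-injective i (j , j∈ , p) =
      T.injective (j , j∈ , ∙-cancelˡ (proj₁ (S.to i)) _ _ (trans p (assoc _ _ _)))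

    product-surjective : ∀ x → ∃₂ λ i l → product i l ~ x
    product-surjective (x , x∈) =
      let i , c , c∈ , p = S.strictlySurjective (x , x∈)
          l , j , j∈ , q = T.strictlySurjective (c , c∈)
      in i , l , j , j∈ , trans p (trans (∙-congˡ q) (sym (assoc _ _ _)))

  -- Left cosets of J inside the double cosets of I and J.

  module DoubleCosets {I J H : Subgroup G} (I≤H : I ≤ₛ H)
                      {n} (R : Representatives n (I ＼ H / J)) {m : Fin n → ℕ}
                      (T : ∀ i → LeftTransversal (m i) I (I ∩ₛ proj₁ (Bijection.to R i) ▷ J))
                      where
    private
      module R = Bijection R
      module T i = Bijection (T i)

    -- I acts on H/J by left multiplication. The orbit of hJ consists of the cosets inside IhJ, and
    -- its stabiliser is I ∩ hJh⁻¹, so for fixed h the elements th list this orbit without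
    -- repetition.
    product : ∀ i → Fin (m i) → Elements H
    product i l = let h , h∈ = R.to i ; t , t∈ = T.to i l in t ∙ h , ∙-closed H (I≤H t∈) h∈

    open Setoid (H / J) using () renaming (_≈_ to _~_)

    product-disjoint : ∀ {i i′ l l′} → product i l ~ product i′ l′ → i ≡ i′
    product-disjoint {i} {i′} {l} {l′} (j , j∈ , p) =
      let h , _ = R.to i ; h′ , _ = R.to i′ ; t , t∈ = T.to i l ; t′ , t′∈ = T.to i′ l′ in
      R.injective
        ( t′ \\ t , j , ∙-closed I (⁻¹-closed I t′∈) t∈ , j∈
        , (begin
            h′                     ≈⟨ y≈x\\z t′ h′ _ p ⟩
            t′ \\ (t ∙ h ∙ j)      ≈⟨ assoc _ _ _ ⟨
            (t′ \\ (t ∙ h)) ∙ j    ≈⟨ ∙-congʳ (assoc _ _ _) ⟨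
            (t′ \\ t) ∙ h ∙ j      ∎))

    product-injective : ∀ i {l l′} → product i l ~ product i l′ → l ≡ l′
    product-injective i {l} {l′} (j , j∈ , p) =
      let h , _ = R.to i ; t , t∈ = T.to i l ; t′ , t′∈ = T.to i l′
          t′≈ : t′ ≈ t ∙ conjugate h j
          t′≈ = begin
            t′                     ≈⟨ x≈z//y t′ h _ p ⟩
            t ∙ h ∙ j // h         ≈⟨ ∙-congʳ (assoc t h j) ⟩
            t ∙ (h ∙ j) // h       ≈⟨ assoc _ _ _ ⟩
            t ∙ conjugate h j      ∎
      in T.injective i
        ( conjugate h j
        , ( respects I (sym (y≈x\\z t _ t′ (sym t′≈))) (∙-closed I (⁻¹-closed I t∈) t′∈)
          , j , j∈ , refl )
        , t′≈)

    -- Write x = ahb with a in I and b in J, then a = t(hjh⁻¹); the factor h⁻¹h cancels and x =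
    -- th(jb).
    product-surjective : ∀ x → ∃₂ λ i l → product i l ~ x
    product-surjective (x , x∈) =
      let i , a , b , a∈ , b∈ , p = R.strictlySurjective (x , x∈)
          l , c , (_ , j , j∈ , r) , q = T.strictlySurjective i (a , a∈)
          h , _ = R.to i
          t , _ = T.to i l
      in i , l , j ∙ b , ∙-closed J j∈ b∈ , (begin
           x                           ≈⟨ p ⟩
           a ∙ h ∙ b                   ≈⟨ ∙-congʳ (∙-congʳ (trans q (∙-congˡ r))) ⟩
           t ∙ (h ∙ j // h) ∙ h ∙ b    ≈⟨ ∙-congʳ (assoc _ _ _) ⟩
           t ∙ ((h ∙ j // h) ∙ h) ∙ b  ≈⟨ ∙-congʳ (∙-congˡ (//-rightDividesˡ h (h ∙ j))) ⟩
           t ∙ (h ∙ j) ∙ b             ≈⟨ ∙-congʳ (assoc _ _ _) ⟨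
           t ∙ h ∙ j ∙ b               ≈⟨ assoc _ _ _ ⟩
           t ∙ h ∙ (j ∙ b)             ∎)

-- The trace of an invariant element.

module Trace {ℓ} {G : Group ℓ ℓ} (A : Module G) where
  open Module A
  open Subgroups G
  open Cosets G
  open Sum commutativeMonoid
  open FiniteSums commutativeMonoid
  open SetoidReasoning setoid
  private module G = Group G
  open GroupProperties G using (//-rightDividesˡ)

  Invariant : Subgroup G → Carrier → Set ℓ
  Invariant I a = ∀ i → i ∈ₛ I → i · a ≈ a

  ·-sum : ∀ g {n} (t : Fin n → Carrier) → g · sum t ≈ sum (λ k → g · t k)
  ·-sum g {zero}  t = ·-zero A g
  ·-sum g {suc n} t = trans (·-distrib g _ _) (∙-congˡ (·-sum g (t ∘ suc)))

  action : ∀ H → Carrier → Elements H → Carrier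
  action H a (x , _) = x · a

  action-cong : ∀ H I {a} → Invariant I a → Congruent (Setoid._≈_ (H / I)) _≈_ (action H a)
  action-cong H I {a} inv {x , _} {y , _} (i , i∈ , p) = sym (begin
    y · a           ≈⟨ ·-cong p refl ⟩
    (x G.∙ i) · a   ≈⟨ ·-assoc x i a ⟩
    x · i · a       ≈⟨ ·-cong G.refl (inv i i∈) ⟩
    x · a           ∎)

  -- The transversal is an explicit argument: a law can be proved with a transversal adapted to it,
  -- and `trace-independent` then passes to the given one.
  trace : ∀ H I {n} → LeftTransversal n H I → Carrier → Carrier
  trace H I T a = sum (λ k → action H a (Bijection.to T k))

  trace-independent : ∀ H I {m n a} → Invariant I a →
                      (T : LeftTransversal m H I) (T′ : LeftTransversal n H I) →
                      trace H I T a ≈ trace H I T′ a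
  trace-independent H I {a = a} inv =
    sum-representatives {S = H / I} (action H a) (λ {x} {y} → action-cong H I inv {x} {y})

  trace-cong : ∀ H I {n} (T : LeftTransversal n H I) {a b} →
               a ≈ b → trace H I T a ≈ trace H I T b
  trace-cong H I {n} T a≈b = sum-cong-≋ {n} (λ k → ·-cong G.refl a≈b)

  trace-+ : ∀ H I {n} (T : LeftTransversal n H I) a b →
            trace H I T (a + b) ≈ trace H I T a + trace H I T b
  trace-+ H I {n} T a b =
    trans (sum-cong-≋ {n} (λ k → ·-distrib _ a b)) (∑-distrib-+ {n} _ _)

  trace-invariant : ∀ H I {n a} (T : LeftTransversal n H I) →
                    Invariant I a → Invariant H (trace H I T a)
  trace-invariant H I {n} {a} T inv h h∈ = begin
    h · trace H I T a
      ≈⟨ ·-sum h {n} _ ⟩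
    sum (λ k → h · action H a (Bijection.to T k))
      ≈⟨ sum-cong-≋ {n} (λ k → ·-assoc h _ a) ⟨
    trace H I hT a
      ≈⟨ trace-independent H I inv hT T ⟩
    trace H I T a ∎
    where hT = Composition.bijection T (translation H I h∈)

  trace-self : ∀ H {n a} (T : LeftTransversal n H H) → Invariant H a → trace H H T a ≈ a
  trace-self H {a = a} T inv = begin
    trace H H T a   ≈⟨ trace-independent H H inv T (trivialTransversal H) ⟩
    G.ε · a + 0#    ≈⟨ identityʳ _ ⟩
    G.ε · a         ≈⟨ ·-identity a ⟩
    a               ∎

  -- Every representative lies in H and fixes `a`, so the n summands coincide; this makes `ind`
  -- after `res` multiplication by the index.
  trace-invariants : ∀ H I {n a} (T : LeftTransversal n H I) → Invariant H a →
                     let open Mult monoid renaming (_×_ to _×ₘ_) in trace H I T a ≈ n ×ₘ a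
  trace-invariants H I {n} T inv = trans
    (sum-cong-≋ {n} (λ k → let x , x∈ = Bijection.to T k in inv x x∈)) (sum-replicate n)

  -- The transversals chosen for equal subgroups need not agree; `T` is also a transversal of I′ in
  -- H′, so both sums are taken over H′/I′.
  trace-≐ : ∀ H H′ I I′ {m n a} → H ≐ₛ H′ → I ≐ₛ I′ → Invariant I′ a →
            (T : LeftTransversal m H I) (T′ : LeftTransversal n H′ I′) →
            trace H′ I′ T′ a ≈ trace H I T a
  trace-≐ H H′ I I′ e f inv T T′ =
    trace-independent H′ I′ inv T′ (Composition.bijection T (/-cong {H} {H′} {I} {I′} e f))

  conjugate-· : ∀ g x a → conjugate g x · g · a ≈ g · x · a
  conjugate-· g x a = begin
    conjugate g x · g · a         ≈⟨ ·-assoc _ g a ⟨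
    (conjugate g x G.∙ g) · a     ≈⟨ ·-cong (//-rightDividesˡ g (g G.∙ x)) refl ⟩
    (g G.∙ x) · a                 ≈⟨ ·-assoc g x a ⟩
    g · x · a                     ∎

  ·-invariant : ∀ H {a} g → Invariant H a → Invariant (g ▷ H) (g · a)
  ·-invariant H {a} g inv y (x , x∈ , p) = begin
    y · g · a               ≈⟨ ·-cong p refl ⟩
    conjugate g x · g · a   ≈⟨ conjugate-· g x a ⟩
    g · x · a               ≈⟨ ·-cong G.refl (inv x x∈) ⟩
    g · a                   ∎

  ·-trace : ∀ H I {m n a} g → Invariant I a →
            (T : LeftTransversal m H I) (T′ : LeftTransversal n (g ▷ H) (g ▷ I)) →
            g · trace H I T a ≈ trace (g ▷ H) (g ▷ I) T′ (g · a)
  ·-trace H I {m} {a = a} g inv T T′ = begin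
    g · trace H I T a
      ≈⟨ ·-sum g {m} _ ⟩
    sum (λ k → g · action H a (Bijection.to T k))
      ≈⟨ sum-cong-≋ {m} (λ k → conjugate-· g _ a) ⟨
    trace (g ▷ H) (g ▷ I) gTg⁻¹ (g · a)
      ≈⟨ trace-independent (g ▷ H) (g ▷ I) (·-invariant I g inv) gTg⁻¹ T′ ⟩
    trace (g ▷ H) (g ▷ I) T′ (g · a) ∎
    where gTg⁻¹ = Composition.bijection T (conjugation g H I)

  trace-trace : ∀ J I H {m n k a} → J ≤ₛ I → I ≤ₛ H → Invariant J a →
                (S : LeftTransversal n H I) (T : LeftTransversal m I J)
                (U : LeftTransversal k H J) →
                trace H I S (trace I J T a) ≈ trace H J U a
  trace-trace J I H {m} {n} {a = a} J≤I I≤H inv S T U = begin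
    trace H I S (trace I J T a)
      ≈⟨ sum-cong-≋ {n} (λ i → trans (·-sum _ {m} _)
           (sum-cong-≋ {m} (λ l → sym (·-assoc _ _ a)))) ⟩
    sum (λ i → sum (λ l → action H a (product i l)))
      ≈⟨ sum-representatives-partition {S = H / J} (action H a)
           (λ {x} {y} → action-cong H J inv {x} {y})
           U product product-disjoint product-injective product-surjective ⟩
    trace H J U a ∎
    where open Tower {J} {I} {H} J≤I I≤H S T

  -- Each inner trace expands to the terms (th)a, with t in I modulo the stabiliser of hJ. Over all
  -- h the elements th represent each coset in H/J once.
  trace-doubleCosets :
    ∀ I J H {k n a} → I ≤ₛ H → Invariant J a →
    (U : LeftTransversal k H J) (R : Representatives n (I ＼ H / J)) {m : Fin n → ℕ}
    (T : ∀ i → LeftTransversal (m i) I (I ∩ₛ proj₁ (Bijection.to R i) ▷ J)) →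
    trace H J U a ≈
      sum (λ i → let h = proj₁ (Bijection.to R i) in trace I (I ∩ₛ h ▷ J) (T i) (h · a))
  trace-doubleCosets I J H {n = n} {a} I≤H inv U R {m} T = sym (begin
    sum (λ i → let h = proj₁ (Bijection.to R i) in trace I (I ∩ₛ h ▷ J) (T i) (h · a))
      ≈⟨ sum-cong-≋ {n} (λ i → sum-cong-≋ {m i} (λ l → sym (·-assoc _ _ a))) ⟩
    sum (λ i → sum (λ l → action H a (product i l)))
      ≈⟨ sum-representatives-partition {S = H / J} (action H a)
           (λ {x} {y} → action-cong H J inv {x} {y})
           U product product-disjoint product-injective product-surjective ⟩
    trace H J U a ∎)
    where open DoubleCosets {I} {J} {H} I≤H R T

-- Homomorphisms of abelian groups from additive maps.

mkHom : ∀ {ℓ} (B C : AbelianGroup ℓ ℓ) →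
        let module B = AbelianGroup B ; module C = AbelianGroup C in
        (f : B.Carrier → C.Carrier) → Congruent B._≈_ C._≈_ f →
        (∀ x y → f (x B.∙ y) C.≈ f x C.∙ f y) → Hom B C
mkHom B C f f-cong homo = record
  { ⟦_⟧ = f
  ; isGroupHomomorphism = record
    { isMonoidHomomorphism = record
      { isMagmaHomomorphism = record
        { isRelHomomorphism = record { cong = f-cong }
        ; homo              = homo
        }
      ; ε-homo = ε-homo
      }
    ; ⁻¹-homo = λ x → inverseˡ-unique _ _
        (C.trans (C.sym (homo _ _)) (C.trans (f-cong (B.inverseˡ x)) ε-homo))
    }
  }
  where
  module B = AbelianGroup B
  module C = AbelianGroup C
  open GroupProperties C.group using (inverseˡ-unique; identityˡ-unique)
  ε-homo : f B.ε C.≈ C.ε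
  ε-homo = identityˡ-unique _ _ (C.trans (C.sym (homo B.ε B.ε)) (f-cong (B.identityˡ B.ε)))

-- The functor of invariants.

module H⁰ {ℓ} {G : Group ℓ ℓ} (𝔖 : SubgroupSystem G) (𝔖-finite : IFinite 𝔖) (A : Module G) where
  open Module A
  open Subgroups G
  open SubgroupSystem 𝔖
  open Trace A
  open Objects (invariantObjects A 𝔖) using (obj; ∣_∣)
  private module G = Group G

  -- I-finiteness supplies one transversal for each pair, and `ind` is defined with it; `isH⁰` shows
  -- that every other one gives the same map.
  transversal : ∀ {H I} (m : I ∈ⁱ H) → LeftTransversal _ (proj₁ H) (proj₁ I)
  transversal {H} {I} m = proj₂ (𝔖-finite {H} {I} m)

  structure : RICStructure (invariantObjects A 𝔖)
  structure = record
    { res = λ {I} {H} m → mkHom (obj H) (obj I)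
        (λ (a , inv) → a , λ h h∈ → inv h (r.∈⋆⇒≤ m h∈)) (λ p → p) (λ _ _ → refl)
    ; ind = λ {(H , _)} {(I , _)} m → mkHom (invariants A I) (invariants A H)
        (λ (a , inv) → trace H I (transversal m) a , trace-invariant H I (transversal m) inv)
        (trace-cong H I (transversal m))
        (λ (a , _) (b , _) → trace-+ H I (transversal m) a b)
    ; con = λ g H → mkHom (obj H) (obj (g ▷ᵇ H))
        (λ (a , inv) → g · a , ·-invariant (proj₁ H) g inv)
        (·-cong G.refl) (λ (a , _) (b , _) → ·-distrib g a b)
    -- Equality of invariants compares the underlying elements of A, which `cast` and `res` leave
    -- unchanged; laws between these maps therefore hold by `refl`.
    ; res-cong = λ _ _ _ _ _ → refl
    ; ind-cong = λ {(I , _)} {(I′ , _)} {(H , _)} {(H′ , _)} e f m m′ (a , inv) →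
        trace-≐ H H′ I I′ f e (λ i i∈ → inv i (proj₂ e i∈)) (transversal m) (transversal m′)
    ; con-cong = λ p _ _ _ _ → ·-cong (G.sym p) refl
    ; res-id = λ _ _ → refl
    ; ind-id = λ H (a , inv) → trace-self (proj₁ H) (transversal (i.self H)) inv
    ; con-id = λ _ (a , _) → ·-identity a
    ; res-res = λ _ _ _ → refl
    ; ind-ind = λ {(J , _)} {(I , _)} {(H , _)} m n (a , inv) →
        trace-trace J I H (i.∈⋆⇒≤ m) (i.∈⋆⇒≤ n) inv
          (transversal n) (transversal m) (transversal (i.tower m n))
    ; con-con = λ g′ g _ (a , _) → sym (·-assoc g′ g a)
    ; con-res = λ _ _ _ → refl
    ; con-ind = λ g {(I , _)} {(H , _)} m (a , inv) →
        ·-trace H I g inv (transversal m) (transversal (i.conj g m))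
    }

  isH⁰ : IsH⁰ A structure
  isH⁰ = record
    { res-inclusion = λ _ _ → refl
    ; ind-sum       = λ {(H , _)} {(I , _)} m T (a , inv) →
        trace-independent H I inv (transversal m) T
    ; con-action    = λ _ _ _ → refl
    }

  -- The index is the length of the chosen transversal, which itself is the witness required by
  -- `HasIndex`.
  cohomological : IsCohomological structure
  cohomological {I} {H} m n = k , transversal n , λ x@(a , inv) →
    trans (trace-invariants (proj₁ H) (proj₁ I) (transversal n) inv) (sym (proj₁-× k x))
    where
    k = proj₁ (𝔖-finite {H} {I} n)
    open Mult monoid renaming (_×_ to _×ₘ_)
    open Mult (AbelianGroup.monoid (obj H)) using () renaming (_×_ to _×ᴴ_)
    -- Both multiples unfold only by recursion on k, so induction is needed to compare them.
    proj₁-× : ∀ k x → proj₁ (k ×ᴴ x) ≈ k ×ₘ proj₁ x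
    proj₁-× zero    x = refl
    proj₁-× (suc k) x = ∙-congˡ (proj₁-× k x)

  stable : IsStable structure
  stable H h h∈ (a , inv) = inv h h∈

  -- On underlying elements `res` and `cast` are the identity, so the summand at h is the trace of
  -- `h · a` from I ∩ hJh⁻¹ to I, and `trace-doubleCosets` applies.
  mackey : (M : IsMackeySystem 𝔖) → IsMackeyFunctor structure M
  mackey M = record
    { stable        = stable
    ; mackeyFormula = λ {H} {I} {J} m n R x@(a , inv) → trans
        (trace-doubleCosets (proj₁ I) (proj₁ J) (proj₁ H) (r.∈⋆⇒≤ m) inv (transversal n) R
          -- These are the very transversals through which `ind` acts in `mackeySummand`, so the
          -- terms match by computation.
          (λ i → transversal (∩-ind m (▷-ind (proj₂ (Bijection.to R i)) n))))
        (sym (proj₁-sum I (λ i → mackeySummand structure M m n (Bijection.to R i) x)))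
    }
    where
    open IsMackeySystem M
    open Sum commutativeMonoid using (sum)
    proj₁-sum : ∀ I {n} (t : Fin n → ∣ I ∣) →
                let open Sum (AbelianGroup.commutativeMonoid (obj I))
                      using () renaming (sum to sumᴵ) in
                proj₁ (sumᴵ t) ≈ sum (proj₁ ∘ t)
    proj₁-sum I {zero}  t = refl
    proj₁-sum I {suc n} t = ∙-congˡ (proj₁-sum I (t ∘ suc))

proposition2p3p4 : ∀ {ℓ} (G : TopologicalGroup ℓ) (𝔖 : SubgroupSystem (TopologicalGroup.group G)) →
    IFinite 𝔖 → (A : DiscreteModule G) →
    Σ[ A⋆ ∈ RICStructure (invariantObjects (DiscreteModule.module′ A) 𝔖) ]
    IsH⁰ (DiscreteModule.module′ A) A⋆ ×
    IsCohomological A⋆ ×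
    IsStable A⋆ ×
    ((M : IsMackeySystem 𝔖) → IsCohomological A⋆ × IsMackeyFunctor A⋆ M)
proposition2p3p4 G 𝔖 𝔖-finite A =
  structure , isH⁰ , cohomological , stable , λ M → cohomological , mackey M
  where open H⁰ 𝔖 𝔖-finite (DiscreteModule.module′ A)
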